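{- Let $G$ be a graph such that for some integers $d,c\geq 0$ and $k\geq 1$: (1) at most $d$ vertices in $G$ have infinite degree; (2) $G$ does not contain $k$ pairwise disjoint 1-way infinite paths; and (3) every finite subgraph of $G$ has path-width at most $c$. Then $\mathrm{pw}(G)\leq 2c+(3k-2)(2c+1)+d$.
   Context: All graphs are simple and countable (the vertex set is finite or countably infinite). A graph $U$ contains a graph $G$ if a subgraph of $U$ is isomorphic to $G$. Paths are disjoint if they are vertex-disjoint subgraphs. The 1-way infinite path is, up to isomorphism, the graph with vertex set $\mathbb{N}$ and edge set $\{\{n,n+1\}:n\in\mathbb{N}\}$. A path-decomposition of a graph $G$ is a sequence $(B_t:t\in\mathbb{N})$ of subsets of $V(G)$ (bags) such that: $\bigcup_{t}B_t=V(G)$; for each edge $vw\in E(G)$ there is $t\in\mathbb{N}$ with $v,w\in B_t$; and $B_{t_1}\cap B_{t_3}\subseteq B_{t_2}$ whenever $t_1\leq t_2\leq t_3$. Its width is $\sup_{t\in\mathbb{N}}(|B_t|-1)$. The path-width $\mathrm{pw}(G)$ is the minimum width of a path-decomposition of $G$ (it is $\infty$ if every path-decomposition has bags of unbounded size). -}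

module Defs where

open import Data.Fin using (Fin)
open import Data.Nat using (ℕ; suc; _≤_)
open import Data.Product using (Σ-syntax; ∃-syntax; _×_)
open import Data.Refinement using (Refinement; value)
open import Data.Sum using (_⊎_; inj₁; inj₂)
open import Function.Bundles using (_↔_; _⇔_; Inverse)
open import Level using (0ℓ) renaming (suc to lsuc)
open import Relation.Binary.Core using (Rel)
open import Relation.Binary.Definitions using (Symmetric; Irreflexive)
open import Relation.Binary.PropositionalEquality using (_≡_; _≢_; refl)
open import Relation.Nullary using (¬_)
open import Relation.Unary using (Pred; _∈_; _⊆_; _∩_; Empty)

Countable : Set → Set
Countable A = (∃[ n ] A ↔ Fin n) ⊎ (A ↔ ℕ)

-- Membership proofs are irrelevant in a Refinement, so its elements are
-- counted by their values only, even if S is not proposition-valued.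
HasCardinality : {A : Set} → Pred A 0ℓ → ℕ → Set
HasCardinality {A} S n = Refinement A S ↔ Fin n

Finite : {A : Set} → Pred A 0ℓ → Set
Finite S = ∃[ n ] HasCardinality S n

∣_∣≤_ : {A : Set} → Pred A 0ℓ → ℕ → Set
∣ S ∣≤ n = ∃[ m ] HasCardinality S m × m ≤ n

record Graph : Set₁ where
  field
    V        : Set
    E        : Rel V 0ℓ
    E-sym    : Symmetric E
    E-irrefl : Irreflexive _≡_ E

record _≅_ (G H : Graph) : Set where
  private
    module G = Graph G
    module H = Graph H
  field
    vertices : G.V ↔ H.V
    edges    : ∀ u v → G.E u v ⇔ H.E (Inverse.to vertices u) (Inverse.to vertices v)

module _ (G : Graph) where
  open Graph G

  record Subgraph : Set₁ where
    field
      vertices : Pred V 0ℓ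
      edges    : Rel V 0ℓ
      edges-E  : ∀ {u v} → edges u v → E u v
      edges-V  : ∀ {u v} → edges u v → u ∈ vertices × v ∈ vertices
      sym      : Symmetric edges

  InfiniteDegree : Pred V 0ℓ
  InfiniteDegree v = ¬ Finite (E v)

  record PathDecomposition : Set₁ where
    field
      bag           : ℕ → Pred V 0ℓ
      covers-vertex : ∀ v → ∃[ t ] v ∈ bag t
      covers-edge   : ∀ {v w} → E v w → ∃[ t ] v ∈ bag t × w ∈ bag t
      interpolation : ∀ {t₁ t₂ t₃} → t₁ ≤ t₂ → t₂ ≤ t₃ → bag t₁ ∩ bag t₃ ⊆ bag t₂

  -- A supremum is at most n iff all its terms are, and |B| - 1 ≤ n is
  -- written |B| ≤ n + 1 so that empty bags need no negative numbers.
  Width≤ : PathDecomposition → ℕ → Set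
  Width≤ D n = ∀ t → ∣ PathDecomposition.bag D t ∣≤ suc n

  -- Path-width is a minimum of widths, so it is at most n iff some width is.
  pw≤ : ℕ → Set₁
  pw≤ n = Σ[ D ∈ PathDecomposition ] Width≤ D n

toGraph : {G : Graph} → Subgraph G → Graph
toGraph {G} S = record
  { V        = Refinement (Graph.V G) vertices
  ; E        = λ u v → edges (value u) (value v)
  ; E-sym    = sym
  ; E-irrefl = λ { refl e → Graph.E-irrefl G refl (edges-E e) }
  }
  where open Subgraph S

Ray : Graph
Ray = record
  { V        = ℕ
  ; E        = λ m n → n ≡ suc m ⊎ m ≡ suc n
  ; E-sym    = λ { (inj₁ p) → inj₂ p ; (inj₂ p) → inj₁ p }
  ; E-irrefl = λ { refl (inj₁ ()) ; refl (inj₂ ()) }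
  }

Disjoint : {G : Graph} → Subgraph G → Subgraph G → Set
Disjoint S T = Empty (Subgraph.vertices S ∩ Subgraph.vertices T)

ContainsDisjointRays : Graph → ℕ → Set₁
ContainsDisjointRays G k =
  Σ[ P ∈ (Fin k → Subgraph G) ]
    (∀ i → toGraph (P i) ≅ Ray) ×
    (∀ i j → i ≢ j → Disjoint (P i) (P j))

{-# OPTIONS --safe #-}
-- Put the vertices of infinite degree into every bag; the rest of the graph is
-- locally finite. There, every finite set X is separated from infinity by at most
-- (k - 1)(c + 1) vertices: otherwise, for every n, the path-decomposition of the ball
-- of radius n around X yields k disjoint paths of length n starting in X (greedily,
-- as a path occupies an interval of bags), and König's lemma yields k disjoint rays.
-- So the graph is exhausted by finite sets with boundaries of at most (k - 1)(c + 1)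
-- vertices. Decompose the finite piece between two consecutive boundaries, add both
-- boundaries to all its bags, and concatenate. The bags have at most
-- (2k - 1)(c + 1) + d ≤ (3k - 1)(2c + 1) + d vertices.

module Submission where

open import Defs
open import Axiom.ExcludedMiddle using (ExcludedMiddle)
open import Data.Empty using (⊥-elim)
open import Data.Fin using (Fin; zero; suc)
open import Data.Irrelevant using ([_])
open import Data.List as List
  using (List; []; _∷_; _++_; length; deduplicate; concatMap; filter; map; allFin; cartesianProductWith)
open import Data.List.Membership.Propositional using (_∈_; _∉_; lose)
open import Data.List.Membership.Propositional.Properties
  using (∈-++⁺ˡ; ∈-++⁺ʳ; ∈-++⁻; ∈-filter⁺; ∈-filter⁻; ∈-concatMap⁺; ∈-cartesianProductWith⁺;
         ∈-map⁺; ∈-map⁻; ∈-allFin; ∈-lookup; ∈-deduplicate⁺; ∈-deduplicate⁻)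
open import Data.List.Properties
  using (length-++; length-filter; length-map; length-tabulate; length-deduplicate)
open import Data.List.Relation.Unary.All as All using ()
open import Data.List.Relation.Unary.AllPairs using (_∷_)
open import Data.List.Relation.Unary.Any as Any using (here; there)
open import Data.List.Relation.Unary.Any.Properties using (lookup-index)
open import Data.List.Relation.Unary.Unique.DecPropositional.Properties using (deduplicate-!)
open import Data.List.Relation.Unary.Unique.Propositional using (Unique)
open import Data.Nat
  using (ℕ; zero; suc; _+_; _*_; _∸_; _≤_; _<_; _⊔_; z≤n; s≤s; _<?_; _≤?_; _≤′_; ≤′-reflexive; ≤′-step)
open import Data.Nat.Properties
  using (module ≤-Reasoning; ≤-refl; ≤-reflexive; ≤-trans; ≤-pred; ≤⇒≤′; <-irrefl; <-trans; <-≤-trans; <-cmp;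
         <⇒≤; ≰⇒>; ≮⇒≥; n≤1+n; m≤n⇒m<n∨m≡n; m≤m⊔n; m≤n⊔m; m≤m+n; m≤n+m; +-comm;
         +-mono-≤; +-monoˡ-≤; +-monoʳ-≤; *-monoˡ-≤; *-monoʳ-≤; *-distribʳ-+; *-suc)
open import Data.Product using (Σ-syntax; ∃; ∃-syntax; _×_; _,_; proj₁; proj₂; swap)
open import Data.Refinement using (Refinement; value; value-injective; _,_)
open import Data.Sum as Sum using (_⊎_; inj₁; inj₂; [_,_]′)
open import Data.Unit using (⊤; tt)
open import Data.Vec using (Vec; []; _∷_; lookup; tabulate; toList)
open import Data.Vec.Properties using (lookup∘tabulate)
open import Function using (_∘_; Inverse; mk↔ₛ′; mk⇔)
open import Level using (0ℓ)
open import Relation.Binary.Definitions using (DecidableEquality; tri<; tri≈; tri>)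
open import Relation.Binary.PropositionalEquality using (_≡_; _≢_; refl; sym; trans; cong; subst)
open import Relation.Nullary using (¬_; Dec; yes; no; contradiction)
open import Relation.Nullary.Decidable using (decidable-stable; recompute)

-- Finite sets as lists.

Bounded : {A : Set} → (A → Set) → Set
Bounded P = ∃[ l ] (∀ {x} → P x → x ∈ l)

bounded-⋃ : {A B : Set} {P : A → B → Set} (xs : List A) →
  (∀ {x} → x ∈ xs → Bounded (P x)) → Bounded (λ y → ∃[ x ] x ∈ xs × P x y)
bounded-⋃ [] _ = [] , λ ()
bounded-⋃ (x ∷ xs) b with b (here refl) | bounded-⋃ xs (b ∘ there)
... | l , P⊆l | m , ⋃⊆m = l ++ m , λ where
  (_ , here refl , p)  → ∈-++⁺ˡ (P⊆l p)
  (_ , there x∈xs , p) → ∈-++⁺ʳ l (⋃⊆m (_ , x∈xs , p))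

uniform-bound : {A : Set} {Q : A → ℕ → Set} →
  (∀ {x m n} → m ≤ n → Q x m → Q x n) → (xs : List A) →
  (∀ {x} → x ∈ xs → ∃ (Q x)) → ∃[ N ] (∀ {x} → x ∈ xs → Q x N)
uniform-bound mono [] _ = 0 , λ ()
uniform-bound mono (x ∷ xs) q with q (here refl) | uniform-bound mono xs (q ∘ there)
... | m , qm | n , qn = m ⊔ n , λ where
  (here refl)  → mono (m≤m⊔n m n) qm
  (there x∈xs) → mono (m≤n⊔m m n) (qn x∈xs)

choices : {A : Set} {k : ℕ} → (Fin k → List A) → List (Vec A k)
choices {k = zero}  F = [] ∷ []
choices {k = suc k} F = cartesianProductWith _∷_ (F zero) (choices (F ∘ suc))

∈-choices : {A : Set} {k : ℕ} (F : Fin k → List A) (ys : Vec A k) →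
  (∀ i → lookup ys i ∈ F i) → ys ∈ choices F
∈-choices F []       _  = here refl
∈-choices F (y ∷ ys) ∈F = ∈-cartesianProductWith⁺ _∷_ (∈F zero) (∈-choices (F ∘ suc) ys (∈F ∘ suc))

lookup-∈-toList : {A : Set} {k : ℕ} (xs : Vec A k) (i : Fin k) → lookup xs i ∈ toList xs
lookup-∈-toList (x ∷ xs) zero    = here refl
lookup-∈-toList (x ∷ xs) (suc i) = there (lookup-∈-toList xs i)

∈-toList⁻ : {A : Set} {k : ℕ} (xs : Vec A k) {v : A} → v ∈ toList xs → ∃[ i ] v ≡ lookup xs i
∈-toList⁻ (x ∷ xs) (here refl) = zero , refl
∈-toList⁻ (x ∷ xs) (there v∈) with ∈-toList⁻ xs v∈
... | i , eq = suc i , eq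

length-concatMap : {A B : Set} (f : A → List B) {w : ℕ} → (∀ x → length (f x) ≤ w) →
  ∀ xs → length (concatMap f xs) ≤ length xs * w
length-concatMap f f≤ [] = z≤n
length-concatMap f {w} f≤ (x ∷ xs) = begin
  length (f x ++ concatMap f xs)         ≡⟨ length-++ (f x) ⟩
  length (f x) + length (concatMap f xs) ≤⟨ +-mono-≤ (f≤ x) (length-concatMap f f≤ xs) ⟩
  w + length xs * w                      ∎
  where open ≤-Reasoning

-- Without repetitions an entry determines its position, whatever the membership proof; this makes
-- counting a duplicate-free list by `Fin` a bijection.
index-unique : {A : Set} {l : List A} → Unique l → ∀ i (p : List.lookup l i ∈ l) → Any.index p ≡ i
index-unique (x∉ ∷ _) zero    (here _)  = refl
index-unique (x∉ ∷ _) zero    (there p) = contradiction refl (All.lookup x∉ p)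
index-unique (x∉ ∷ _) (suc i) (here eq) = contradiction (sym eq) (All.lookup x∉ (∈-lookup i))
index-unique (_ ∷ u)  (suc i) (there p) = cong suc (index-unique u i p)

-- Sequences of stages 0, 1, 2, ..., where stage n consists of the steps 0, ..., T n,
-- traversed one step at a time.
module Traversal (T : ℕ → ℕ) where
  step : ℕ × ℕ → ℕ × ℕ
  step (n , s) with s <? T n
  ... | yes _ = n , suc s
  ... | no  _ = suc n , 0

  pos : ℕ → ℕ × ℕ
  pos zero    = 0 , 0
  pos (suc t) = step (pos t)

  _≼_ : ℕ × ℕ → ℕ × ℕ → Set
  (m , r) ≼ (n , s) = m < n ⊎ (m ≡ n × r ≤ s)

  ≼-trans : ∀ {p q r} → p ≼ q → q ≼ r → p ≼ r
  ≼-trans (inj₁ l)          (inj₁ l′)          = inj₁ (<-trans l l′)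
  ≼-trans (inj₁ l)          (inj₂ (refl , _))  = inj₁ l
  ≼-trans (inj₂ (refl , _)) (inj₁ l)           = inj₁ l
  ≼-trans (inj₂ (refl , l)) (inj₂ (refl , l′)) = inj₂ (refl , ≤-trans l l′)

  ≼-step : ∀ p → p ≼ step p
  ≼-step (n , s) with s <? T n
  ... | yes _ = inj₂ (refl , n≤1+n s)
  ... | no  _ = inj₁ ≤-refl

  pos-mono : ∀ {t u} → t ≤ u → pos t ≼ pos u
  pos-mono {t} t≤u = go (≤⇒≤′ t≤u)
    where
    go : ∀ {u} → t ≤′ u → pos t ≼ pos u
    go (≤′-reflexive refl) = inj₂ (refl , ≤-refl)
    go (≤′-step l)         = ≼-trans (go l) (≼-step _)

  -- Stage `suc n` is entered from the last step `T n` of stage `n`, so every stage is reached and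
  -- none of its steps is skipped.
  pos-onto : ∀ n s → s ≤ T n → ∃[ t ] pos t ≡ (n , s)
  pos-onto zero zero _ = 0 , refl
  pos-onto (suc n) zero _ with pos-onto n (T n) ≤-refl
  ... | t , eq = suc t , trans (cong step eq) last
    where
    last : step (n , T n) ≡ (suc n , 0)
    last with T n <? T n
    ... | yes l = contradiction l (<-irrefl refl)
    ... | no  _ = refl
  pos-onto n (suc s) s<T with pos-onto n s (<⇒≤ s<T)
  ... | t , eq = suc t , trans (cong step eq) next
    where
    next : step (n , s) ≡ (n , suc s)
    next with s <? T n
    ... | yes _ = refl
    ... | no  l = contradiction s<T l

-- Path-decompositions with lists as bags.

-- `F` is the set being decomposed; `E` need not be restricted to it. Repetitions in a bag are
-- harmless, since only an upper bound on its size matters. `w` bounds bag sizes and so is one more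
-- than a bound on the width.
record ListDecomposition {V : Set} (E : V → V → Set) (F : V → Set) (w : ℕ) : Set where
  field
    bag           : ℕ → List V
    small         : ∀ t → length (bag t) ≤ w
    bag⊆          : ∀ {t v} → v ∈ bag t → F v
    covers-vertex : ∀ {v} → F v → ∃[ t ] v ∈ bag t
    covers-edge   : ∀ {u v} → F u → F v → E u v → ∃[ t ] u ∈ bag t × v ∈ bag t
    interpolation : ∀ {t₁ t₂ t₃} → t₁ ≤ t₂ → t₂ ≤ t₃ →
                    ∀ {v} → v ∈ bag t₁ → v ∈ bag t₃ → v ∈ bag t₂

module _ {V : Set} {E : V → V → Set} {H : List V} {w : ℕ} (L : ListDecomposition E (_∈ H) w) where
  open ListDecomposition L

  -- Cuts the infinite sequence of bags off at a step `T` by which every vertex has occurred, so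
  -- that another piece can follow.
  vertices-bound : ∃[ T ] (∀ {v} → v ∈ H → ∃[ s ] s ≤ T × v ∈ bag s)
  vertices-bound = uniform-bound (λ m≤n (s , s≤m , v∈) → s , ≤-trans s≤m m≤n , v∈) H
    λ v∈H → let s , v∈ = covers-vertex v∈H in s , s , ≤-refl , v∈

  -- An edge covered later than `T` has both ends in the bag at `T`: each end has occurred by then
  -- and occurs again later.
  edge-bound : ∀ {T} → (∀ {v} → v ∈ H → ∃[ s ] s ≤ T × v ∈ bag s) →
    ∀ {u v} → u ∈ H → v ∈ H → E u v → ∃[ s ] s ≤ T × u ∈ bag s × v ∈ bag s
  edge-bound {T} T-bound u∈H v∈H e with covers-edge u∈H v∈H e | T-bound u∈H | T-bound v∈H
  ... | s , u∈s , v∈s | r , r≤T , u∈r | q , q≤T , v∈q with s ≤? T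
  ... | yes s≤T = s , s≤T , u∈s , v∈s
  ... | no  s≰T = T , ≤-refl , interpolation r≤T T≤s u∈r u∈s , interpolation q≤T T≤s v∈q v∈s
    where T≤s = <⇒≤ (≰⇒> s≰T)

-- Joint injectivity of `p` says in one condition that each sequence is a path and that different
-- sequences are disjoint.
DisjointRays : {V : Set} → (V → V → Set) → ℕ → Set
DisjointRays {V} E k = Σ[ p ∈ (ℕ → Fin k → V) ]
  (∀ n i → E (p n i) (p (suc n) i)) ×
  (∀ {m n i j} → p m i ≡ p n j → m ≡ n × i ≡ j)

-- Classical principles.

module _ (em : ExcludedMiddle 0ℓ) where

  dne : {P : Set} → ¬ ¬ P → P
  dne = decidable-stable em

  ¬∀⇒∃¬ : {A : Set} {P : A → Set} → ¬ (∀ x → P x) → ∃[ x ] ¬ P x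
  ¬∀⇒∃¬ ¬∀ = dne λ ¬∃ → ¬∀ λ x → dne λ ¬p → ¬∃ (x , ¬p)

  -- If every entry failed for some number, it would fail for all larger ones, and a common bound
  -- would defeat the whole finite list at once.
  pigeonhole : {A : Set} {Q : A → ℕ → Set} →
    (∀ {x m n} → m ≤ n → Q x n → Q x m) → (xs : List A) →
    (∀ n → ∃[ x ] x ∈ xs × Q x n) → ∃[ x ] x ∈ xs × (∀ n → Q x n)
  pigeonhole {Q = Q} anti xs q = dne λ ¬∃ →
    let N , ¬q = uniform-bound {Q = λ x n → ¬ Q x n} (λ m≤n ¬p → ¬p ∘ anti m≤n) xs
                   (λ {x} x∈xs → ¬∀⇒∃¬ λ ∀q → ¬∃ (x , x∈xs , ∀q))
        x , x∈xs , p = q N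
    in ¬q x∈xs p

  least : {P : ℕ → Set} → ∀ n → P n → ∃[ m ] P m × (∀ {j} → j < m → ¬ P j)
  least zero p = 0 , p , λ ()
  least {P} (suc n) p with em {P 0}
  ... | yes p₀ = 0 , p₀ , λ ()
  ... | no ¬p₀ with least {P ∘ suc} n p
  ... | m , pm , min = suc m , pm , min-suc
    where
    min-suc : ∀ {j} → j < suc m → ¬ P j
    min-suc {zero}  _         = ¬p₀
    min-suc {suc j} (s≤s j<m) = min j<m

  -- Long paths in locally finite graphs.

  module LocallyFinite {V : Set} (E : V → V → Set)
    (nbrs : V → List V) (E⇒nbrs : ∀ {u v} → E u v → v ∈ nbrs u) where

    _∖_ : (V → Set) → V → (V → Set)
    (U ∖ x) v = U v × v ≢ x

    data Reach (U : V → Set) (x : V) : V → Set where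
      here : U x → Reach U x x
      _▸_  : ∀ {y z} → Reach U x y → E y z × U z → Reach U x z

    -- Long n U x: some path with n edges starts at x and stays in U.
    Long : ℕ → (V → Set) → V → Set
    Long zero    U x = U x
    Long (suc n) U x = U x × ∃[ y ] E x y × Long n (U ∖ x) y

    Long⇒∈ : ∀ n {U x} → Long n U x → U x
    Long⇒∈ zero    Ux       = Ux
    Long⇒∈ (suc n) (Ux , _) = Ux

    Long-mono : ∀ n {U W x} → (∀ {v} → U v → W v) → Long n U x → Long n W x
    Long-mono zero    U⊆W Ux               = U⊆W Ux
    Long-mono (suc n) U⊆W (Ux , y , e , l) =
      U⊆W Ux , y , e , Long-mono n (λ (Uv , v≢x) → U⊆W Uv , v≢x) l

    -- No edge of the path leads out of `W`. This keeps a path on one side of a deleted bag.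
    Long-∩ : ∀ n {U x} (W : V → Set) → (∀ {u v} → U u → U v → E u v → W u → W v) →
      W x → Long n U x → Long n (λ v → U v × W v) x
    Long-∩ zero    W closed Wx Ux = Ux , Wx
    Long-∩ (suc n) W closed Wx (Ux , y , e , l) = (Ux , Wx) , y , e ,
      Long-mono n (λ ((Uv , v≢x) , Wv) → (Uv , Wv) , v≢x)
        (Long-∩ n W (λ (Uu , _) (Uv , _) → closed Uu Uv) (closed Ux (proj₁ (Long⇒∈ n l)) e Wx) l)

    Reach-start : ∀ {U x z} → Reach U x z → U x
    Reach-start (here Ux) = Ux
    Reach-start (r ▸ _)   = Reach-start r

    -- Cut the walk at its last visit to x.
    last-exit : ∀ {U x z} → Reach U x z → z ≡ x ⊎ ∃[ y ] E x y × Reach (U ∖ x) y z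
    last-exit (here _) = inj₁ refl
    last-exit {x = x} {z} (r ▸ (e , Uz)) with em {z ≡ x}
    ... | yes z≡x = inj₁ z≡x
    ... | no  z≢x with last-exit r
    ... | inj₁ refl         = inj₂ (z , e , here (Uz , z≢x))
    ... | inj₂ (y , e′ , r′) = inj₂ (y , e′ , r′ ▸ (e , Uz , z≢x))

    -- Apart from `x` itself, everything reached from `x` is reached from one of its finitely many
    -- neighbours after `x` is deleted. Were all these sets finite, so would be their union.
    unbounded-step : ∀ {U x} → ¬ Bounded (Reach U x) → ∃[ y ] E x y × ¬ Bounded (Reach (U ∖ x) y)
    unbounded-step {U} {x} unb = dne λ ¬∃ →
      -- `nbrs x` may list vertices not adjacent to `x`; with the edge inside the predicate, these
      -- contribute the empty set.
      let l , ⊆l = bounded-⋃ {P = λ y z → E x y × Reach (U ∖ x) y z} (nbrs x) λ {y} _ → dne λ ¬b →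
            ¬b ([] , λ {z} (e , _) → ⊥-elim (¬∃ (y , e , λ (m , ⊆m) → ¬b (m , ⊆m ∘ proj₂))))
      in unb (x ∷ l , λ r → [ (λ { refl → here refl }) ,
                              (λ (y , e , r′) → there (⊆l (y , E⇒nbrs e , e , r′))) ]′ (last-exit r))

    unbounded⇒Long : ∀ n {U x} → ¬ Bounded (Reach U x) → Long n U x
    unbounded⇒Long zero    unb = dne λ ¬Ux → unb ([] , λ r → contradiction (Reach-start r) ¬Ux)
    unbounded⇒Long (suc n) unb with unbounded-step unb
    ... | y , e , unb′ = unbounded⇒Long zero unb , y , e , unbounded⇒Long n unb′

    ball : ℕ → List V → List V
    ball zero    X = X
    ball (suc n) X = X ++ ball n (concatMap nbrs X)

    Long-ball : ∀ n {U x X} → x ∈ X → Long n U x → Long n (λ v → U v × v ∈ ball n X) x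
    Long-ball zero    x∈X Ux = Ux , x∈X
    Long-ball (suc n) {X = X} x∈X (Ux , y , e , l) = (Ux , ∈-++⁺ˡ x∈X) , y , e ,
      Long-mono n (λ ((Uv , v≢x) , v∈) → (Uv , ∈-++⁺ʳ X v∈) , v≢x)
        (Long-ball n (∈-concatMap⁺ nbrs (lose x∈X (E⇒nbrs e))) l)

    -- Greedy choice of disjoint paths.

    Escape : ℕ → List V → (V → Set) → Set
    Escape n X U = ∃[ x ] x ∈ X × Long n U x

    -- `Long` does not name the vertices of its path, so disjointness is asked of regions that
    -- contain the paths.
    record DisjointPaths (n j : ℕ) (X : List V) (W : V → Set) : Set₁ where
      field
        start    : Fin j → V
        region   : Fin j → V → Set
        start∈   : ∀ i → start i ∈ X
        long     : ∀ i → Long n (region i) (start i)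
        region⊆  : ∀ i {v} → region i v → W v
        disjoint : ∀ i i′ {v} → region i v → region i′ v → i ≡ i′

    -- Pick the path whose interval of bags ends first, delete the last bag of that
    -- interval, and continue to the right of it.
    module Greedy {H : List V} {w : ℕ} (L : ListDecomposition E (_∈ H) w) (n : ℕ) (X : List V) where
      open ListDecomposition L

      Before From : ℕ → V → Set
      Before t v = ∃[ s ] s < t × v ∈ bag s
      From   t v = v ∈ H × ¬ Before t v

      -- If the bag covering the edge came at `t` or later, interpolation between it and the earlier
      -- bag of `u` would put `u` into `bag t`.
      before-closed : ∀ {t u v} → u ∈ H → v ∈ H → u ∉ bag t → E u v → Before t u → Before t v
      before-closed {t} u∈H v∈H u∉t e (s , s<t , u∈s) with covers-edge u∈H v∈H e
      ... | r , u∈r , v∈r with r <? t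
      ... | yes r<t = r , r<t , v∈r
      ... | no  r≮t = contradiction (interpolation (<⇒≤ s<t) (≮⇒≥ r≮t) u∈s u∈r) u∉t

      after-closed : ∀ {t u v} → u ∈ H → v ∈ H → v ∉ bag t → E u v → ¬ Before t u → ¬ Before t v
      after-closed {t} u∈H v∈H v∉t e ¬b (s , s<t , v∈s) with covers-edge u∈H v∈H e
      ... | r , u∈r , v∈r with r <? t
      ... | yes r<t = ¬b (r , r<t , u∈r)
      ... | no  r≮t = v∉t (interpolation (<⇒≤ s<t) (≮⇒≥ r≮t) v∈s v∈r)

      from-suc : ∀ {t v} → v ∈ H → v ∉ bag t → ¬ Before t v → From (suc t) v
      from-suc v∈H v∉t ¬b = v∈H , λ (s , s<1+t , v∈s) →
        [ (λ s<t → ¬b (s , s<t , v∈s)) , (λ { refl → v∉t v∈s }) ]′ (m≤n⇒m<n∨m≡n (≤-pred s<1+t))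

      -- Each chosen path costs one deleted bag, so `j` paths need an escape from fewer than `j`
      -- bags. Later paths live in `From (suc t)`, away from all vertices that have occurred by `t`.
      greedy : ∀ j t₀ →
        (∀ ts → length ts < j → Escape n X (λ v → From t₀ v × (∀ t → t ∈ ts → v ∉ bag t))) →
        DisjointPaths n j X (From t₀)
      greedy zero t₀ _ = record
        { start = λ () ; region = λ () ; start∈ = λ () ; long = λ () ; region⊆ = λ () ; disjoint = λ () }
      greedy (suc j) t₀ esc with vertices-bound L | esc [] (s≤s z≤n)
      ... | T , T-bound | x₀ , x₀∈X , l₀
        -- By step `T` every vertex of `H` has occurred, so `suc T` qualifies; the least choice
        -- gives a path whose vertices have all occurred as early as possible.
        with least {λ t → Escape n X (λ v → From t₀ v × Before t v)} (suc T)
               (x₀ , x₀∈X , Long-mono n (λ (f@(v∈H , _) , _) →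
                 f , let s , s≤T , v∈s = T-bound v∈H in s , s≤s s≤T , v∈s) l₀)
      ... | zero , (_ , _ , l) , _ = contradiction (proj₂ (Long⇒∈ n l)) λ ()
      ... | suc t , (x , x∈X , l) , min = record
        { start    = λ { zero → x ; (suc i) → R.start i }
        ; region   = λ { zero v → From t₀ v × Before (suc t) v ; (suc i) → R.region i }
        ; start∈   = λ { zero → x∈X ; (suc i) → R.start∈ i }
        ; long     = λ { zero → l ; (suc i) → R.long i }
        ; region⊆  = λ { zero → proj₁ ; (suc i) → from-mono ∘ R.region⊆ i }
        ; disjoint = λ where
            zero    zero     _       _       → refl
            zero    (suc i′) (_ , b) r       → contradiction b (proj₂ (R.region⊆ i′ r))
            (suc i) zero     r       (_ , b) → contradiction b (proj₂ (R.region⊆ i r))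
            (suc i) (suc i′) r       r′      → cong suc (R.disjoint i i′ r r′)
        }
        where
        t₀≤1+t : t₀ ≤ suc t
        t₀≤1+t with Long⇒∈ n l
        ... | (_ , ¬b) , s , s<1+t , x∈s = ≮⇒≥ λ 1+t<t₀ → ¬b (s , <-trans s<1+t 1+t<t₀ , x∈s)

        from-mono : ∀ {v} → From (suc t) v → From t₀ v
        from-mono (v∈H , ¬b) = v∈H , λ (s , s<t₀ , v∈s) → ¬b (s , <-≤-trans s<t₀ t₀≤1+t , v∈s)

        rest : DisjointPaths n j X (From (suc t))
        rest = greedy j (suc t) λ ts ts<j → escape ts (esc (t ∷ ts) (s≤s ts<j))
          where
          escape : ∀ ts → Escape n X (λ v → From t₀ v × (∀ s → s ∈ t ∷ ts → v ∉ bag s)) →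
            Escape n X (λ v → From (suc t) v × (∀ s → s ∈ ts → v ∉ bag s))
          -- A path avoiding `bag t` cannot cross it. On the left of `t` it would contradict the
          -- minimality of `suc t`; so all its vertices first occur after `t`.
          escape ts (y , y∈X , ly) with em {Before t y}
          ... | yes b = contradiction (y , y∈X , Long-mono n (λ ((f , _) , b′) → f , b′) before) (min ≤-refl)
            where
            before = Long-∩ n (Before t)
              (λ ((u∈H , _) , u∉) ((v∈H , _) , _) → before-closed u∈H v∈H (u∉ t (here refl))) b ly
          ... | no ¬b = y , y∈X , Long-mono n (λ (((v∈H , _) , v∉) , ¬b′) →
                          from-suc v∈H (v∉ t (here refl)) ¬b′ , λ s → v∉ s ∘ there) after
            where
            after = Long-∩ n (¬_ ∘ Before t)
              (λ ((u∈H , _) , _) ((v∈H , _) , v∉) → after-closed u∈H v∈H (v∉ t (here refl))) ¬b ly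
        module R = DisjointPaths rest

    -- König's lemma for disjoint rays.

    Fresh : {k : ℕ} → List V → Vec V k → Set
    Fresh used xs = (∀ {i j} → lookup xs i ≡ lookup xs j → i ≡ j) × (∀ i → lookup xs i ∉ used)

    -- Ext n used xs: k disjoint paths with n edges each, started at xs and explored
    -- in lockstep, avoid the vertices in used.
    Ext : {k : ℕ} → List V → ℕ → Vec V k → Set
    Ext used zero    xs = Fresh used xs
    Ext used (suc n) xs = Fresh used xs ×
      ∃[ ys ] (∀ i → E (lookup xs i) (lookup ys i)) × Ext (toList xs ++ used) n ys

    Ext-fresh : ∀ {k used} n {xs : Vec V k} → Ext used n xs → Fresh used xs
    Ext-fresh zero    f       = f
    Ext-fresh (suc n) (f , _) = f

    Ext-anti : ∀ {k used m n} {xs : Vec V k} → m ≤ n → Ext used n xs → Ext used m xs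
    Ext-anti {n = n} z≤n e                      = Ext-fresh n e
    Ext-anti (s≤s m≤n) (f , ys , edges , e) = f , ys , edges , Ext-anti m≤n e

    Long⇒Ext : ∀ {k used} n {xs : Vec V k} (U : Fin k → V → Set) →
      (∀ i → Long n (U i) (lookup xs i)) →
      (∀ {i j v} → U i v → U j v → i ≡ j) → (∀ i {v} → U i v → v ∉ used) → Ext used n xs
    Long⇒Ext {used = used} n {xs} U long disj U#used = go n long
      where
      fresh : (∀ i → U i (lookup xs i)) → Fresh used xs
      fresh U∋ = (λ {i} {j} eq → disj (U∋ i) (subst (U j) (sym eq) (U∋ j))) , λ i → U#used i (U∋ i)
      go : ∀ n → (∀ i → Long n (U i) (lookup xs i)) → Ext used n xs
      go zero    long = fresh long
      go (suc n) long = fresh (proj₁ ∘ long) , ys , (λ i → subst (E _) (sym (ys≡ i)) (proj₁ (proj₂ (next i)))) ,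
        Long⇒Ext n (λ i → U i ∖ lookup xs i)
          (λ i → subst (Long n _) (sym (ys≡ i)) (proj₂ (proj₂ (next i))))
          (λ (Ui , _) (Uj , _) → disj Ui Uj)
          -- A tip lying in region `i` can only be the tip of path `i`, which has just been deleted
          -- from that region.
          λ i (Uiv , v≢xi) → [ (λ v∈xs → let j , v≡xj = ∈-toList⁻ xs v∈xs
                                             i≡j = disj Uiv (subst (U j) (sym v≡xj) (proj₁ (long j)))
                                         in v≢xi (trans v≡xj (cong (lookup xs) (sym i≡j)))) ,
                               U#used i Uiv ]′ ∘ ∈-++⁻ (toList xs)
        where
        next : ∀ i → ∃[ y ] E (lookup xs i) y × Long n (U i ∖ lookup xs i) y
        next = proj₂ ∘ long
        ys : Vec V _
        ys = tabulate (proj₁ ∘ next)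
        ys≡ : ∀ i → lookup ys i ≡ proj₁ (next i)
        ys≡ = lookup∘tabulate (proj₁ ∘ next)

    -- The state of König's argument: a finite stretch of the paths that has extensions of every
    -- length.
    record Front (k : ℕ) : Set where
      field
        used : List V
        tips : Vec V k
        ext  : ∀ n → Ext used n tips

    -- Local finiteness leaves finitely many vectors of next tips, so one of them serves for all
    -- lengths. The equation on `used` lets earlier tips be found again.
    Front-step : ∀ {k} (S : Front k) → Σ[ S′ ∈ Front k ]
      (∀ i → E (lookup (Front.tips S) i) (lookup (Front.tips S′) i)) ×
      Front.used S′ ≡ toList (Front.tips S) ++ Front.used S
    Front-step S =
      let ys , _ , good = pigeonhole
            {Q = λ ys n → (∀ i → E (lookup tips i) (lookup ys i)) × Ext (toList tips ++ used) n ys}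
            (λ m≤n (edges , e) → edges , Ext-anti m≤n e)
            (choices (λ i → nbrs (lookup tips i)))
            λ n → let _ , ys , edges , e = ext (suc n)
                  in ys , ∈-choices _ ys (E⇒nbrs ∘ edges) , edges , e
      in record { used = toList tips ++ used ; tips = ys ; ext = proj₂ ∘ good } , proj₁ (good 0) , refl
      where open Front S

    Front⇒DisjointRays : ∀ {k} → Front k → DisjointRays E k
    Front⇒DisjointRays {k} S₀ = p , (λ n → proj₁ (proj₂ (Front-step (front n)))) , p-injective
      where
      open Front
      front : ℕ → Front k
      front zero    = S₀
      front (suc n) = proj₁ (Front-step (front n))

      p : ℕ → Fin k → V
      p n = lookup (tips (front n))

      ∈used : ∀ {m n} → m < n → ∀ i → p m i ∈ used (front n)
      ∈used {m} {suc n} (s≤s m≤n) i = subst (p m i ∈_) (sym (proj₂ (proj₂ (Front-step (front n)))))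
        ([ (λ m<n → ∈-++⁺ʳ (toList (tips (front n))) (∈used m<n i)) ,
           (λ { refl → ∈-++⁺ˡ (lookup-∈-toList (tips (front n)) i) }) ]′ (m≤n⇒m<n∨m≡n m≤n))

      fresh : ∀ n → Fresh (used (front n)) (tips (front n))
      fresh n = Ext-fresh 0 {tips (front n)} (ext (front n) 0)

      -- Tips of an earlier round are used by the time of a later one, whose fresh tips avoid them;
      -- within one round, freshness includes distinctness.
      p-injective : ∀ {m n i j} → p m i ≡ p n j → m ≡ n × i ≡ j
      p-injective {m} {n} {i} {j} eq with <-cmp m n
      ... | tri< m<n _ _  = contradiction (subst (_∈ _) eq (∈used m<n i)) (proj₂ (fresh n) j)
      ... | tri≈ _ refl _ = refl , proj₁ (fresh n) eq
      ... | tri> _ _ n<m  = contradiction (subst (_∈ _) (sym eq) (∈used n<m j)) (proj₂ (fresh m) i)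

    -- Small separators.

    module NoRays (E-sym : ∀ {u v} → E u v → E v u) (w k : ℕ)
      (no-rays : ¬ DisjointRays E (suc k)) (decompose : ∀ H → ListDecomposition E (_∈ H) w) where

      record Separation (X : List V) : Set where
        field
          interior  : List V
          separator : List V
          separator-small : length separator ≤ k * w
          X⊆     : ∀ {v} → v ∈ X → v ∈ interior ⊎ v ∈ separator
          closed : ∀ {u v} → u ∈ interior → E u v → v ∈ interior ⊎ v ∈ separator

      -- The greedy choice of `suc k` paths deletes at most `k` bags at a time, hence at most
      -- `k * w` vertices. If no such set cut `X` off from infinity, the choice would succeed for
      -- every `n` and lead to the excluded rays.
      separate : ∀ X → Separation X
      separate X with em {∃[ S ] length S ≤ k * w × Bounded (λ v → ∃[ x ] x ∈ X × Reach (_∉ S) x v)}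
      ... | yes (S , S≤ , l , ⊆l) = record
        { interior = filter reached? l
        ; separator = S
        ; separator-small = S≤
        ; X⊆ = λ v∈X → dichotomy λ v∉S → _ , v∈X , here v∉S
        ; closed = λ u∈ e → dichotomy λ v∉S →
            let _ , x , x∈X , r = ∈-filter⁻ reached? {xs = l} u∈ in x , x∈X , r ▸ (e , v∉S)
        }
        where
        reached? : ∀ v → Dec (∃[ x ] x ∈ X × Reach (_∉ S) x v)
        reached? _ = em
        dichotomy : ∀ {v} → (v ∉ S → ∃[ x ] x ∈ X × Reach (_∉ S) x v) → v ∈ filter reached? l ⊎ v ∈ S
        dichotomy {v} r with em {v ∈ S}
        ... | yes v∈S = inj₂ v∈S
        ... | no  v∉S = inj₁ (∈-filter⁺ reached? (⊆l (r v∉S)) (r v∉S))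
      ... | no ¬sep = contradiction (Front⇒DisjointRays front) no-rays
        where
        escape : ∀ n S → length S ≤ k * w → Escape n X (_∉ S)
        escape n S S≤ = dne λ ¬esc → ¬sep (S , S≤ , bounded-⋃ X λ x∈X → dne λ unb →
          ¬esc (_ , x∈X , unbounded⇒Long n unb))

        ext : ∀ n → ∃[ xs ] xs ∈ choices {k = suc k} (λ _ → X) × Ext [] n xs
        ext n = xs , ∈-choices _ xs (λ i → subst (_∈ X) (sym (xs≡ i)) (start∈ i)) ,
          Long⇒Ext n region (λ i → subst (Long n _) (sym (xs≡ i)) (long i)) (disjoint _ _) λ _ _ ()
          where
          -- A path with `n` edges that starts in `X` stays inside this ball, so the decomposition
          -- sees all of it.
          L = decompose (ball n X)
          open ListDecomposition L
          open Greedy L n X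
          paths : DisjointPaths n (suc k) X (From 0)
          paths = greedy (suc k) 0 λ ts ts≤k →
            let x , x∈X , l = escape n (concatMap bag ts)
                  (≤-trans (length-concatMap bag small ts) (*-monoˡ-≤ w (≤-pred ts≤k)))
            in x , x∈X , Long-mono n (λ (v∉ , v∈H) → (v∈H , λ { (_ , () , _) }) ,
                 λ t t∈ts v∈t → v∉ (∈-concatMap⁺ bag (lose t∈ts v∈t))) (Long-ball n x∈X l)
          open DisjointPaths paths
          xs = tabulate start
          xs≡ = lookup∘tabulate start

        front : Front (suc k)
        -- `X` is finite, so one vector of starting vertices works for every `n`.
        front = let xs , _ , e = pigeonhole Ext-anti (choices (λ _ → X)) ext
                in record { used = [] ; tips = xs ; ext = e }

      -- Exhaustion by finite stages.

      record Stage : Set where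
        field
          interior boundary : List V
          small    : length boundary ≤ k * w
          disjoint : ∀ {v} → v ∈ boundary → v ∉ interior
          closed   : ∀ {u v} → u ∈ interior → E u v → v ∈ interior ⊎ v ∈ boundary

      Within : Stage → V → Set
      Within A v = v ∈ Stage.interior A ⊎ v ∈ Stage.boundary A

      empty : Stage
      empty = record { interior = [] ; boundary = [] ; small = z≤n ; disjoint = λ () ; closed = λ () }

      -- The old boundary is separated together with `xs`, so neighbours of the old interior stay
      -- within the new stage. The new separator replaces the old boundary, so sizes do not add up.
      extend : (A : Stage) (xs : List V) → Σ[ B ∈ Stage ]
        (∀ {v} → Within A v → Within B v) × (∀ {v} → v ∈ xs → Within B v) ×
        (∀ {v} → v ∈ Stage.interior A → v ∈ Stage.interior B)
      extend A xs = B , [ inj₁ ∘ ∈-++⁺ˡ , within ∘ X⊆ ∘ ∈-++⁺ˡ ]′ , within ∘ X⊆ ∘ ∈-++⁺ʳ boundary , ∈-++⁺ˡ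
        where
        open Stage A
        open Separation (separate (boundary ++ xs)) renaming (interior to new; closed to new-closed)

        outside? : ∀ v → Dec (v ∉ interior ++ new)
        outside? _ = em

        within : ∀ {v} → v ∈ new ⊎ v ∈ separator → v ∈ interior ++ new ⊎ v ∈ filter outside? separator
        within {v} v∈ with em {v ∈ interior ++ new} | v∈
        ... | yes v∈B | _        = inj₁ v∈B
        ... | no  _   | inj₁ v∈N = inj₁ (∈-++⁺ʳ interior v∈N)
        ... | no  v∉B | inj₂ v∈S = inj₂ (∈-filter⁺ outside? v∈S v∉B)

        B : Stage
        B = record
          { interior = interior ++ new
          -- The separator may meet the old interior; such vertices are dropped to keep boundary and
          -- interior disjoint.
          ; boundary = filter outside? separator
          ; small    = ≤-trans (length-filter outside? separator) separator-small
          ; disjoint = proj₂ ∘ ∈-filter⁻ outside? {xs = separator}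
          ; closed   = λ u∈ e → [ (λ u∈I → [ inj₁ ∘ ∈-++⁺ˡ , within ∘ X⊆ ∘ ∈-++⁺ˡ ]′ (closed u∈I e)) ,
                                  (λ u∈N → within (new-closed u∈N e)) ]′ (∈-++⁻ interior u∈)
          }

      module Exhaustion (enum : ℕ → List V) (enum-covers : ∀ v → ∃[ n ] v ∈ enum n) where

        stage : ℕ → Stage
        stage zero    = empty
        stage (suc n) = proj₁ (extend (stage n) (enum n))

        open Stage hiding (small)

        within-mono : ∀ {m n v} → m ≤ n → Within (stage m) v → Within (stage n) v
        within-mono {n = zero}  z≤n v∈ = v∈
        within-mono {n = suc n} m≤1+n v∈ with m≤n⇒m<n∨m≡n m≤1+n
        ... | inj₁ (s≤s m≤n) = proj₁ (proj₂ (extend (stage n) (enum n))) (within-mono m≤n v∈)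
        ... | inj₂ refl      = v∈

        interior-mono : ∀ {m n v} → m ≤ n → v ∈ interior (stage m) → v ∈ interior (stage n)
        interior-mono {n = zero}  z≤n v∈ = v∈
        interior-mono {n = suc n} m≤1+n v∈ with m≤n⇒m<n∨m≡n m≤1+n
        ... | inj₁ (s≤s m≤n) = proj₂ (proj₂ (proj₂ (extend (stage n) (enum n)))) (interior-mono m≤n v∈)
        ... | inj₂ refl      = v∈

        exhausts : ∀ v → ∃[ n ] Within (stage n) v
        exhausts v = let n , v∈ = enum-covers v in suc n , proj₁ (proj₂ (proj₂ (extend (stage n) (enum n)))) v∈

        -- Concatenation of the pieces between boundaries.

        outside? : ∀ n v → Dec (v ∉ interior (stage n))
        outside? _ _ = em

        vertices : ℕ → List V
        vertices n = interior (stage n) ++ boundary (stage n)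

        -- Only the old interior is removed, not the old boundary, so consecutive pieces overlap
        -- exactly in the boundary between them.
        piece : ℕ → List V
        piece n = filter (outside? n) (vertices (suc n))

        ∈-piece : ∀ {n v} → Within (stage (suc n)) v → v ∉ interior (stage n) → v ∈ piece n
        ∈-piece {n} v∈ = ∈-filter⁺ (outside? n) ([ ∈-++⁺ˡ , ∈-++⁺ʳ (interior (stage (suc n))) ]′ v∈)

        piece-within : ∀ {n v} → v ∈ piece n → Within (stage (suc n)) v
        piece-within {n} = ∈-++⁻ (interior (stage (suc n))) ∘ proj₁ ∘ ∈-filter⁻ (outside? n) {xs = vertices (suc n)}

        piece-outside : ∀ {n v} → v ∈ piece n → v ∉ interior (stage n)
        piece-outside {n} = proj₂ ∘ ∈-filter⁻ (outside? n) {xs = vertices (suc n)}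

        L : ∀ n → ListDecomposition E (_∈ piece n) w
        L n = decompose (piece n)

        open ListDecomposition
        open Traversal (λ n → proj₁ (vertices-bound (L n)))

        -- Both boundaries are repeated in every bag so that a vertex shared by two pieces never
        -- drops out between them.
        bagAt : ℕ × ℕ → List V
        bagAt (n , s) = bag (L n) s ++ boundary (stage n) ++ boundary (stage (suc n))

        bagAt-small : ∀ p → length (bagAt p) ≤ w + (k * w + k * w)
        bagAt-small (n , s) = begin
          length (bagAt (n , s))
            ≡⟨ length-++ (bag (L n) s) ⟩
          length (bag (L n) s) + length (boundary (stage n) ++ boundary (stage (suc n)))
            ≡⟨ cong (length (bag (L n) s) +_) (length-++ (boundary (stage n))) ⟩
          length (bag (L n) s) + (length (boundary (stage n)) + length (boundary (stage (suc n))))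
            ≤⟨ +-mono-≤ (small (L n) s) (+-mono-≤ (Stage.small (stage n)) (Stage.small (stage (suc n)))) ⟩
          w + (k * w + k * w) ∎
          where open ≤-Reasoning

        ∈-bagAt⁻ : ∀ {n s v} → v ∈ bagAt (n , s) →
          v ∈ bag (L n) s ⊎ v ∈ boundary (stage n) ++ boundary (stage (suc n))
        ∈-bagAt⁻ {n} {s} = ∈-++⁻ (bag (L n) s)

        boundary⇒bagAt : ∀ {n s v} → v ∈ boundary (stage n) ++ boundary (stage (suc n)) → v ∈ bagAt (n , s)
        boundary⇒bagAt {n} {s} = ∈-++⁺ʳ (bag (L n) s)

        bagAt-within : ∀ {n s v} → v ∈ bagAt (n , s) → Within (stage (suc n)) v
        bagAt-within {n} v∈ with ∈-bagAt⁻ v∈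
        ... | inj₁ v∈L = piece-within {n} (bag⊆ (L n) v∈L)
        ... | inj₂ v∈S = [ within-mono (n≤1+n n) ∘ inj₂ , inj₂ ]′ (∈-++⁻ (boundary (stage n)) v∈S)

        bagAt-outside : ∀ {n s v} → v ∈ bagAt (n , s) → v ∉ interior (stage n)
        bagAt-outside {n} v∈ with ∈-bagAt⁻ v∈
        ... | inj₁ v∈L = piece-outside {n} (bag⊆ (L n) v∈L)
        ... | inj₂ v∈S = [ disjoint (stage n) ,
                           (λ v∈S′ → disjoint (stage (suc n)) v∈S′ ∘ interior-mono (n≤1+n n)) ]′
                         (∈-++⁻ (boundary (stage n)) v∈S)

        -- A vertex of `bagAt r` avoids the interior of the stage of `r` and of all earlier ones. If
        -- `p` is in an earlier stage than `q`, the vertex lies within the stage of `q`, hence on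
        -- its first boundary; if `r` is in a later stage than `q`, the same argument gives the
        -- second one.
        bagAt-interpolation : ∀ {p q r} → p ≼ q → q ≼ r → ∀ {v} → v ∈ bagAt p → v ∈ bagAt r → v ∈ bagAt q
        bagAt-interpolation {q = q} (inj₁ m<n) q≼r v∈p v∈r with within-mono m<n (bagAt-within v∈p)
        ... | inj₁ v∈I = contradiction (interior-mono (stage≤ q≼r) v∈I) (bagAt-outside v∈r)
          where
          stage≤ : ∀ {q r} → q ≼ r → proj₁ q ≤ proj₁ r
          stage≤ (inj₁ l)          = <⇒≤ l
          stage≤ (inj₂ (refl , _)) = ≤-refl
        ... | inj₂ v∈S = boundary⇒bagAt {proj₁ q} (∈-++⁺ˡ v∈S)
        bagAt-interpolation {q = n , _} (inj₂ (refl , _)) (inj₁ n<o) v∈p v∈r with bagAt-within v∈p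
        ... | inj₁ v∈I = contradiction (interior-mono n<o v∈I) (bagAt-outside v∈r)
        ... | inj₂ v∈S = boundary⇒bagAt {n} (∈-++⁺ʳ (boundary (stage n)) v∈S)
        bagAt-interpolation {q = n , _} (inj₂ (refl , a≤b)) (inj₂ (refl , b≤c)) v∈p v∈r
          with ∈-bagAt⁻ v∈p | ∈-bagAt⁻ v∈r
        ... | inj₂ v∈S | _        = boundary⇒bagAt {n} v∈S
        ... | inj₁ _   | inj₂ v∈S = boundary⇒bagAt {n} v∈S
        ... | inj₁ v∈a | inj₁ v∈c = ∈-++⁺ˡ (interpolation (L n) a≤b b≤c v∈a v∈c)

        vertex-piece : ∀ v → ∃[ n ] v ∈ piece n
        vertex-piece v with least {λ n → Within (stage n) v} (proj₁ (exhausts v)) (proj₂ (exhausts v))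
        ... | zero  , inj₁ () , _
        ... | zero  , inj₂ () , _
        ... | suc n , v∈ , min = n , ∈-piece {n} v∈ (min ≤-refl ∘ inj₁)

        -- Take the first stage that contains both ends. An end in the interior of the preceding
        -- stage would bring the other end into that stage, against minimality.
        edge-piece : ∀ {u v} → E u v → ∃[ n ] u ∈ piece n × v ∈ piece n
        edge-piece {u} {v} e
          with exhausts u | exhausts v
        ... | m , u∈m | o , v∈o
          with least {λ n → Within (stage n) u × Within (stage n) v} (m ⊔ o)
                 (within-mono (m≤m⊔n m o) u∈m , within-mono (m≤n⊔m m o) v∈o)
        ... | zero  , (inj₁ () , _) , _
        ... | zero  , (inj₂ () , _) , _
        ... | suc n , (u∈ , v∈) , min = n ,
          ∈-piece {n} u∈ (λ u∈I → min ≤-refl (inj₁ u∈I , closed (stage n) u∈I e)) ,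
          ∈-piece {n} v∈ (λ v∈I → min ≤-refl (closed (stage n) v∈I (E-sym e) , inj₁ v∈I))

        atPos : ∀ {n s} → s ≤ proj₁ (vertices-bound (L n)) →
          ∃[ t ] (∀ {v} → v ∈ bag (L n) s → v ∈ bagAt (pos t))
        atPos {n} {s} s≤T with pos-onto n s s≤T
        ... | t , eq = t , λ v∈ → subst (λ p → _ ∈ bagAt p) (sym eq) (∈-++⁺ˡ v∈)

        decomposition : ListDecomposition E (λ _ → ⊤) (w + (k * w + k * w))
        decomposition = record
          { bag           = bagAt ∘ pos
          ; small         = bagAt-small ∘ pos
          ; bag⊆          = λ _ → tt
          ; covers-vertex = λ {v} _ →
              let n , v∈ = vertex-piece v
                  s , s≤T , v∈s = proj₂ (vertices-bound (L n)) v∈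
                  t , ⊆t = atPos {n} s≤T
              in t , ⊆t v∈s
          ; covers-edge   = λ _ _ e →
              let n , u∈ , v∈ = edge-piece e
                  s , s≤T , u∈s , v∈s = edge-bound (L n) (proj₂ (vertices-bound (L n))) u∈ v∈ e
                  t , ⊆t = atPos {n} s≤T
              in t , ⊆t u∈s , ⊆t v∈s
          ; interpolation = λ t₁≤t₂ t₂≤t₃ → bagAt-interpolation (pos-mono t₁≤t₂) (pos-mono t₂≤t₃)
          }

  -- Translation between lists and the given definitions.

  HasCardinality⇒list : {A : Set} {S : A → Set} {n : ℕ} → HasCardinality S n →
    ∃[ l ] length l ≡ n × (∀ {x} → S x → x ∈ l) × (∀ {x} → x ∈ l → S x)
  HasCardinality⇒list {A} {S} {n} S↔ = map element (allFin n) ,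
    trans (length-map element (allFin n)) (length-tabulate {n = n} _) ,
    (λ {x} Sx → subst (_∈ _) (cong value (strictlyInverseʳ (x , [ Sx ])))
                  (∈-map⁺ element (∈-allFin (to (x , [ Sx ]))))) ,
    λ x∈l → let i , _ , x≡ = ∈-map⁻ element x∈l in subst S (sym x≡) (member (from i))
    where
    open Inverse S↔
    element : Fin n → A
    element = value ∘ from
    member : (x : Refinement A S) → S (value x)
    -- Excluded middle decides `S`, which turns the irrelevant proof into a usable one.
    member (_ , [ Sx ]) = recompute em Sx

  ∣list∣≤length : {A : Set} (l : List A) → ∣ (_∈ l) ∣≤ length l
  ∣list∣≤length {A} l = length u , mk↔ₛ′ to from to∘from from∘to , length-deduplicate _≟_ l
    where
    _≟_ : DecidableEquality A
    _ ≟ _ = em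
    u = deduplicate _≟_ l
    to : Refinement A (_∈ l) → Fin (length u)
    to (_ , [ x∈l ]) = Any.index (∈-deduplicate⁺ _≟_ (recompute em x∈l))
    from : Fin (length u) → Refinement A (_∈ l)
    from i = List.lookup u i , [ ∈-deduplicate⁻ _≟_ l (∈-lookup i) ]
    from∘to : ∀ x → from (to x) ≡ x
    from∘to (_ , [ x∈l ]) = value-injective (sym (lookup-index (∈-deduplicate⁺ _≟_ (recompute em x∈l))))
    to∘from : ∀ i → to (from i) ≡ i
    to∘from i = index-unique (deduplicate-! _≟_ l) i _

  -- Lists in place of single elements let a finite vertex set, even an empty one, be treated like
  -- an infinite one.
  Countable⇒enumerable : {A : Set} → Countable A → Σ[ f ∈ (ℕ → List A) ] (∀ x → ∃[ n ] x ∈ f n)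
  Countable⇒enumerable (inj₁ (n , A↔)) = (λ _ → map from (allFin n)) ,
    λ x → 0 , subst (_∈ _) (strictlyInverseʳ x) (∈-map⁺ from (∈-allFin (to x)))
    where open Inverse A↔
  Countable⇒enumerable (inj₂ A↔) = (λ n → from n ∷ []) , λ x → to x , here (sym (strictlyInverseʳ x))
    where open Inverse A↔

  module _ (G : Graph) where
    open Graph G

    induced : List V → Subgraph G
    induced H = record
      { vertices = _∈ H
      ; edges    = λ u v → E u v × u ∈ H × v ∈ H
      ; edges-E  = proj₁
      ; edges-V  = proj₂
      ; sym      = λ (e , u∈H , v∈H) → E-sym e , v∈H , u∈H
      }

    pw≤⇒ListDecomposition : ∀ {c} (H : List V) → pw≤ (toGraph (induced H)) c →
      ListDecomposition E (_∈ H) (suc c)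
    pw≤⇒ListDecomposition {c} H (D , width) = record
      { bag           = map value ∘ elements
      ; small         = small
      ; bag⊆          = λ {t} v∈ → let x , _ , v≡ = ∈-map⁻ value v∈
                                  in subst (_∈ H) (sym v≡) (member x)
      ; covers-vertex = λ {v} v∈H → let t , v∈t = covers-vertex (v , [ v∈H ])
                                    in t , ∈-map⁺ value (elements⁺ t v∈t)
      ; covers-edge   = λ {u} {v} u∈H v∈H e →
          let t , u∈t , v∈t = covers-edge {u , [ u∈H ]} {v , [ v∈H ]} (e , u∈H , v∈H)
          in t , ∈-map⁺ value (elements⁺ t u∈t) , ∈-map⁺ value (elements⁺ t v∈t)
      ; interpolation = interp
      }
      where
      open PathDecomposition D
      list : ∀ t → ∃[ l ] length l ≡ proj₁ (width t) × (∀ {x} → bag t x → x ∈ l) × (∀ {x} → x ∈ l → bag t x)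
      list t = HasCardinality⇒list (proj₁ (proj₂ (width t)))
      elements : ℕ → List (Refinement V (_∈ H))
      elements t = proj₁ (list t)
      elements⁺ : ∀ t {x} → bag t x → x ∈ elements t
      elements⁺ t = proj₁ (proj₂ (proj₂ (list t)))
      elements⁻ : ∀ t {x} → x ∈ elements t → bag t x
      elements⁻ t = proj₂ (proj₂ (proj₂ (list t)))
      small : ∀ t → length (map value (elements t)) ≤ suc c
      small t = begin
        length (map value (elements t)) ≡⟨ length-map value (elements t) ⟩
        length (elements t)             ≡⟨ proj₁ (proj₂ (list t)) ⟩
        proj₁ (width t)                 ≤⟨ proj₂ (proj₂ (width t)) ⟩
        suc c                           ∎
        where open ≤-Reasoning
      member : (x : Refinement V (_∈ H)) → value x ∈ H
      member (_ , [ x∈H ]) = recompute em x∈H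
      interp : ∀ {t₁ t₂ t₃} → t₁ ≤ t₂ → t₂ ≤ t₃ → ∀ {v} →
        v ∈ map value (elements t₁) → v ∈ map value (elements t₃) → v ∈ map value (elements t₂)
      interp {t₁} {t₂} {t₃} t₁≤t₂ t₂≤t₃ v∈₁ v∈₃ with ∈-map⁻ value v∈₁ | ∈-map⁻ value v∈₃
      ... | x , x∈₁ , refl | y , y∈₃ , x≡y = ∈-map⁺ value (elements⁺ t₂ (interpolation t₁≤t₂ t₂≤t₃
              (elements⁻ t₁ x∈₁ , elements⁻ t₃ (subst (_∈ elements t₃) (value-injective (sym x≡y)) y∈₃))))

    ListDecomposition⇒pw≤ : ∀ {n} → ListDecomposition E (λ _ → ⊤) (suc n) → pw≤ G n
    ListDecomposition⇒pw≤ L = record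
      { bag           = λ t → _∈ bag t
      ; covers-vertex = λ _ → covers-vertex tt
      ; covers-edge   = covers-edge tt tt
      ; interpolation = λ t₁≤t₂ t₂≤t₃ (v∈₁ , v∈₃) → interpolation t₁≤t₂ t₂≤t₃ v∈₁ v∈₃
      } , λ t → let m , card , m≤ = ∣list∣≤length (bag t) in m , card , ≤-trans m≤ (small t)
      where open ListDecomposition L

    DisjointRays⇒ContainsDisjointRays : ∀ {k} → DisjointRays E k → ContainsDisjointRays G k
    DisjointRays⇒ContainsDisjointRays {k} (p , p-edge , p-inj) = P , P≅Ray ,
      λ i j i≢j v ((_ , v≡) , (_ , v≡′)) → i≢j (proj₂ (p-inj (trans (sym v≡) v≡′)))
      where
      OnRay : Fin k → V → Set
      OnRay i v = ∃[ n ] v ≡ p n i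
      Step : Fin k → V → V → Set
      Step i u v = ∃[ n ] u ≡ p n i × v ≡ p (suc n) i
      P : Fin k → Subgraph G
      P i = record
        { vertices = OnRay i
        ; edges    = λ u v → Step i u v ⊎ Step i v u
        ; edges-E  = [ step-edge , E-sym ∘ step-edge ]′
        ; edges-V  = [ step-ends , swap ∘ step-ends ]′
        ; sym      = Sum.swap
        }
        where
        step-edge : ∀ {u v} → Step i u v → E u v
        step-edge (n , refl , refl) = p-edge n i
        step-ends : ∀ {u v} → Step i u v → OnRay i u × OnRay i v
        step-ends (n , u≡ , v≡) = (n , u≡) , (suc n , v≡)

      P≅Ray : ∀ i → toGraph (P i) ≅ Ray
      P≅Ray i = record
        { vertices = mk↔ₛ′ index (λ n → p n i , [ n , refl ])
            (λ n → sym (index-determined (p n i , [ n , refl ]) refl))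
            (λ x → value-injective (sym (index-correct x)))
        ; edges = λ u v → mk⇔ (Sum.map (step⇒suc u v) (step⇒suc v u)) (Sum.map (suc⇒step u v) (suc⇒step v u))
        }
        where
        onRay : (x : Refinement V (OnRay i)) → OnRay i (value x)
        onRay (_ , [ x∈ ]) = recompute em x∈
        index : Refinement V (OnRay i) → ℕ
        index = proj₁ ∘ onRay
        index-correct : ∀ x → value x ≡ p (index x) i
        index-correct = proj₂ ∘ onRay
        -- The recomputed proof may differ from the one supplied, but joint injectivity of `p`
        -- leaves only one possible position.
        index-determined : ∀ x {n} → value x ≡ p n i → n ≡ index x
        index-determined x x≡ = proj₁ (p-inj (trans (sym x≡) (index-correct x)))
        step⇒suc : ∀ u v → Step i (value u) (value v) → index v ≡ suc (index u)
        step⇒suc u v (n , u≡ , v≡) = trans (sym (index-determined v v≡)) (cong suc (index-determined u u≡))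
        suc⇒step : ∀ u v → index v ≡ suc (index u) → Step i (value u) (value v)
        suc⇒step u v eq = index u , index-correct u , trans (index-correct v) (cong (λ n → p n i) eq)

    -- All of `A` is in every bag, so an edge meeting `A` is covered by any bag that contains its
    -- other end.
    add-apices : ∀ {w} (A : List V) →
      ListDecomposition (λ u v → E u v × u ∉ A × v ∉ A) (λ _ → ⊤) w →
      ListDecomposition E (λ _ → ⊤) (w + length A)
    add-apices A L = record
      { bag           = λ t → bag t ++ A
      ; small         = λ t → ≤-trans (≤-reflexive (length-++ (bag t))) (+-monoˡ-≤ (length A) (small t))
      ; bag⊆          = λ _ → tt
      ; covers-vertex = λ _ → let t , v∈ = covers-vertex tt in t , ∈-++⁺ˡ v∈
      ; covers-edge   = λ _ _ → edge
      ; interpolation = λ {_} {t₂} t₁≤t₂ t₂≤t₃ v∈₁ v∈₃ →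
          [ (λ v∈₁ → [ ∈-++⁺ˡ ∘ interpolation t₁≤t₂ t₂≤t₃ v∈₁ , ∈-++⁺ʳ (bag t₂) ]′ (∈-++⁻ (bag _) v∈₃)) ,
            ∈-++⁺ʳ (bag t₂) ]′ (∈-++⁻ (bag _) v∈₁)
      }
      where
      open ListDecomposition L
      edge : ∀ {u v} → E u v → ∃[ t ] u ∈ bag t ++ A × v ∈ bag t ++ A
      edge {u} {v} e with em {u ∈ A} | em {v ∈ A}
      ... | yes u∈A | _       = let t , v∈ = covers-vertex tt in t , ∈-++⁺ʳ (bag t) u∈A , ∈-++⁺ˡ v∈
      ... | no  _   | yes v∈A = let t , u∈ = covers-vertex tt in t , ∈-++⁺ˡ u∈ , ∈-++⁺ʳ (bag t) v∈A
      ... | no  u∉A | no  v∉A = let t , u∈ , v∈ = covers-edge tt tt (e , u∉A , v∉A)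
                                in t , ∈-++⁺ˡ u∈ , ∈-++⁺ˡ v∈

theorem1 : ExcludedMiddle 0ℓ →
    (G : Graph) → Countable (Graph.V G) →
    (d c k : ℕ) → 1 ≤ k →
    ∣ InfiniteDegree G ∣≤ d →
    ¬ ContainsDisjointRays G k →
    ((H : Subgraph G) → Finite (Subgraph.vertices H) → pw≤ (toGraph H) c) →
    pw≤ G (2 * c + (3 * k ∸ 2) * (2 * c + 1) + d)
theorem1 em G countable d c (suc k) _ (_ , infinite , ≤d) no-rays finite-pw =
  ListDecomposition⇒pw≤ em G (widen bound (add-apices em G A decomposition))
  where
  open Graph G
  infinite-list = HasCardinality⇒list em infinite
  A = proj₁ infinite-list

  -- Only the edges at vertices of infinite degree are removed: the vertex type stays `V`, and every
  -- remaining neighbourhood is finite.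
  E′ : V → V → Set
  E′ u v = E u v × u ∉ A × v ∉ A

  nbrs : V → List V
  nbrs v with em {Finite (E v)}
  ... | yes (_ , card) = proj₁ (HasCardinality⇒list em card)
  -- Such a vertex is in `A` and has no edge in `E′`, so any default would do.
  ... | no  _          = []

  E′⇒nbrs : ∀ {u v} → E′ u v → v ∈ nbrs u
  E′⇒nbrs {u} (e , u∉A , _) with em {Finite (E u)}
  ... | yes (_ , card) = proj₁ (proj₂ (proj₂ (HasCardinality⇒list em card))) e
  ... | no  infinite-u = contradiction (proj₁ (proj₂ (proj₂ infinite-list)) infinite-u) u∉A

  no-rays′ : ¬ DisjointRays E′ (suc k)
  no-rays′ (p , p-edge , p-inj) =
    no-rays (DisjointRays⇒ContainsDisjointRays em G (p , (λ n i → proj₁ (p-edge n i)) , p-inj))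

  decompose : ∀ H → ListDecomposition E′ (_∈ H) (suc c)
  decompose H = record
    { ListDecomposition L ; covers-edge = λ u∈H v∈H → ListDecomposition.covers-edge L u∈H v∈H ∘ proj₁ }
    where
    L = pw≤⇒ListDecomposition em G H
          (finite-pw (induced em G H) (let m , card , _ = ∣list∣≤length em H in m , card))

  enumeration = Countable⇒enumerable em countable

  open LocallyFinite em E′ nbrs E′⇒nbrs
  open NoRays (λ (e , u∉A , v∉A) → E-sym e , v∉A , u∉A) (suc c) k no-rays′ decompose
  open Exhaustion (proj₁ enumeration) (proj₂ enumeration)

  widen : ∀ {m n} → m ≤ n → ListDecomposition E (λ _ → ⊤) m → ListDecomposition E (λ _ → ⊤) n
  widen m≤n L = record { ListDecomposition L ; small = λ t → ≤-trans (ListDecomposition.small L t) m≤n }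

  -- The left side counts a bag of a piece, two boundaries and the vertices of infinite degree. The
  -- estimate rests on `suc c ≤ q`, `k + k ≤ 3 * k` and `3 * suc k ∸ 2 ≡ suc (3 * k)`; the last
  -- summand `suc (2 * c)` is pure slack.
  bound : suc c + (k * suc c + k * suc c) + length A ≤ suc (2 * c + (3 * suc k ∸ 2) * (2 * c + 1) + d)
  bound = begin
    suc c + (k * suc c + k * suc c) + length A
      ≤⟨ +-mono-≤ (+-mono-≤ 1+c≤q (+-mono-≤ (*-monoʳ-≤ k 1+c≤q) (*-monoʳ-≤ k 1+c≤q)))
           (≤-trans (≤-reflexive (proj₁ (proj₂ infinite-list))) ≤d) ⟩
    q + (k * q + k * q) + d
      ≡⟨ cong (λ x → q + x + d) (*-distribʳ-+ q k k) ⟨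
    q + (k + k) * q + d
      ≤⟨ +-monoˡ-≤ d (+-monoʳ-≤ q (*-monoˡ-≤ q (+-monoʳ-≤ k (m≤m+n k (k + 0))))) ⟩
    suc (3 * k) * q + d
      ≡⟨ cong (λ x → (x ∸ 2) * q + d) (*-suc 3 k) ⟨
    (3 * suc k ∸ 2) * q + d
      ≤⟨ +-monoˡ-≤ d (m≤n+m _ (suc (2 * c))) ⟩
    suc (2 * c) + (3 * suc k ∸ 2) * q + d ∎
    where
    open ≤-Reasoning
    q = 2 * c + 1
    1+c≤q : suc c ≤ q
    1+c≤q = ≤-trans (≤-reflexive (+-comm 1 c)) (+-monoˡ-≤ 1 (m≤m+n c (c + 0)))
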